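{- Every weakly Hopfian finitely presented group is strongly defined by its $\exists^+$-types.
   Context: A group $A$ is weakly Hopfian if every $\alpha\in\mathrm{End}(A)$ having a left inverse (i.e. there is $\beta\in\mathrm{End}(A)$ with $\beta\circ\alpha=\mathrm{id}_A$) is an automorphism of $A$. An $\exists^+$-formula (positive existential formula) is a first-order formula $\exists\bar y\,\theta(\bar x,\bar y)$ in the language of groups with $\theta$ a positive quantifier-free formula (built from equations between words using $\wedge$ and $\vee$). A map $f:A\to B$ between groups is an $\exists^+$-embedding if for every $\exists^+$-formula $\varphi(\bar x)$ and every tuple $\bar a$ from $A$ of the length of $\bar x$: $A\models\varphi(\bar a)$ if and only if $B\models\varphi(f(\bar a))$. A finitely generated group $A$ is strongly defined by its $\exists^+$-types if every $\exists^+$-embedding $f:A\to A$ is an automorphism of $A$. -}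

module Defs where

open import Algebra.Bundles using (Group)
open import Algebra.Morphism.Structures using (module GroupMorphisms)
open import Data.Fin.Base using (Fin)
open import Data.List.Base using (List)
open import Data.List.Membership.Propositional using (_∈_)
open import Data.Nat.Base using (ℕ)
open import Data.Product.Base using (∃; ∃-syntax; _×_; _,_)
open import Data.Sum.Base using (_⊎_; [_,_])
open import Function.Base using (_∘_)
open import Function.Bundles using (Func; _⇔_)
open import Level using (Level; 0ℓ; _⊔_)

private
  variable
    c ℓ c′ ℓ′ : Level
    n : ℕ
    X : Set

------------------------------------------------------------------------
-- Weakly Hopfian groups

module _ (A : Group c ℓ) where
  open Group A
  open GroupMorphisms rawGroup rawGroup

  IsEndomorphism : (Carrier → Carrier) → Set (c ⊔ ℓ)
  IsEndomorphism = IsGroupHomomorphism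

  IsAutomorphism : (Carrier → Carrier) → Set (c ⊔ ℓ)
  IsAutomorphism = IsGroupIsomorphism

  WeaklyHopfian : Set (c ⊔ ℓ)
  WeaklyHopfian =
    ∀ α → IsEndomorphism α →
    (∃[ β ] IsEndomorphism β × (∀ x → β (α x) ≈ x)) →
    IsAutomorphism α

------------------------------------------------------------------------
-- Group words

infixl 7 _·_
infix  8 _⁻

-- Terms of the language of groups, not reduced: the group laws are
-- imposed by the relation _⊢_∼_ below, or by the group of evaluation.

data Word (X : Set) : Set where
  var : X → Word X
  e   : Word X
  _·_ : Word X → Word X → Word X
  _⁻  : Word X → Word X

module _ (A : Group c ℓ) where
  open Group A

  eval : (X → Carrier) → Word X → Carrier
  eval ρ (var x) = ρ x
  eval ρ e       = ε
  eval ρ (s · t) = eval ρ s ∙ eval ρ t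
  eval ρ (s ⁻)   = eval ρ s ⁻¹

------------------------------------------------------------------------
-- Finite generation and finite presentation

FinitelyGenerated : Group c ℓ → Set (c ⊔ ℓ)
FinitelyGenerated A =
  ∃[ n ] ∃[ g ] (∀ x → ∃[ w ] eval A {X = Fin n} g w ≈ x)
  where open Group A using (_≈_)

infix 4 _⊢_∼_

-- The least group congruence on words killing every relator in R, so
-- that words modulo R ⊢_∼_ form the group ⟨ X ∣ R ⟩.

data _⊢_∼_ {X : Set} (R : List (Word X)) : Word X → Word X → Set where
  relator   : ∀ {r} → r ∈ R → R ⊢ r ∼ e
  refl      : ∀ {s} → R ⊢ s ∼ s
  sym       : ∀ {s t} → R ⊢ s ∼ t → R ⊢ t ∼ s
  trans     : ∀ {s t u} → R ⊢ s ∼ t → R ⊢ t ∼ u → R ⊢ s ∼ u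
  ·-cong    : ∀ {s s′ t t′} → R ⊢ s ∼ s′ → R ⊢ t ∼ t′ → R ⊢ s · t ∼ s′ · t′
  ⁻-cong    : ∀ {s t} → R ⊢ s ∼ t → R ⊢ s ⁻ ∼ t ⁻
  assoc     : ∀ s t u → R ⊢ (s · t) · u ∼ s · (t · u)
  identityˡ : ∀ s → R ⊢ e · s ∼ s
  identityʳ : ∀ s → R ⊢ s · e ∼ s
  inverseˡ  : ∀ s → R ⊢ s ⁻ · s ∼ e
  inverseʳ  : ∀ s → R ⊢ s · s ⁻ ∼ e

⟨_∣_⟩ : (X : Set) → List (Word X) → Group 0ℓ 0ℓ
⟨ X ∣ R ⟩ = record
  { Carrier = Word X
  ; _≈_     = R ⊢_∼_
  ; _∙_     = _·_
  ; ε       = e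
  ; _⁻¹     = _⁻
  ; isGroup = record
    { isMonoid = record
      { isSemigroup = record
        { isMagma = record
          { isEquivalence = record { refl = refl ; sym = sym ; trans = trans }
          ; ∙-cong        = ·-cong
          }
        ; assoc = assoc
        }
      ; identity = identityˡ , identityʳ
      }
    ; inverse = inverseˡ , inverseʳ
    ; ⁻¹-cong = ⁻-cong
    }
  }

FinitelyPresented : Group c ℓ → Set (c ⊔ ℓ)
FinitelyPresented A =
  ∃[ n ] ∃[ R ] ∃ (GroupMorphisms.IsGroupIsomorphism
                     (Group.rawGroup ⟨ Fin n ∣ R ⟩) (Group.rawGroup A))

------------------------------------------------------------------------
-- Positive existential formulas

infix  6 _≐_
infixr 5 _∧_
infixr 4 _∨_

data PositiveQF (X : Set) : Set where
  _≐_ : Word X → Word X → PositiveQF X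
  _∧_ : PositiveQF X → PositiveQF X → PositiveQF X
  _∨_ : PositiveQF X → PositiveQF X → PositiveQF X

-- ∃ȳ θ(x̄, ȳ) with x̄ of length n; inj₁ indexes x̄ and inj₂ indexes ȳ.

record ∃⁺Formula (n : ℕ) : Set where
  constructor ∃⁺
  field
    bound  : ℕ
    matrix : PositiveQF (Fin n ⊎ Fin bound)

module _ (A : Group c ℓ) where
  open Group A

  HoldsQF : (X → Carrier) → PositiveQF X → Set ℓ
  HoldsQF ρ (s ≐ t) = eval A ρ s ≈ eval A ρ t
  HoldsQF ρ (θ ∧ η) = HoldsQF ρ θ × HoldsQF ρ η
  HoldsQF ρ (θ ∨ η) = HoldsQF ρ θ ⊎ HoldsQF ρ η

  infix 4 _⊨_[_]

  _⊨_[_] : ∃⁺Formula n → (Fin n → Carrier) → Set (c ⊔ ℓ)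
  _⊨_[_] (∃⁺ k θ) a = ∃[ b ] HoldsQF [ a , b ] θ

-- A map between carriers is a map of groups only if it respects the
-- two equalities, hence Func between the underlying setoids.

Is∃⁺Embedding : (A : Group c ℓ) (B : Group c′ ℓ′) →
                Func (Group.setoid A) (Group.setoid B) → Set (c ⊔ ℓ ⊔ c′ ⊔ ℓ′)
Is∃⁺Embedding A B f =
  ∀ n (φ : ∃⁺Formula n) (a : Fin n → Group.Carrier A) →
  (A ⊨ φ [ a ]) ⇔ (B ⊨ φ [ Func.to f ∘ a ])

-- The notion is only defined for finitely generated groups, hence the
-- first conjunct.

StronglyDefinedBy∃⁺Types : Group c ℓ → Set (c ⊔ ℓ)
StronglyDefinedBy∃⁺Types A =
  FinitelyGenerated A ×
  (∀ f → Is∃⁺Embedding A A f → IsAutomorphism A (Func.to f))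

{-# OPTIONS --safe #-}

-- Let g generate A with finite set of relators R, let f be an
-- ∃⁺-embedding, and write f(gᵢ) = wᵢ(g).  The formula
--   ∃ȳ (⋀_{r ∈ R} r(ȳ) = 1 ∧ ⋀ᵢ xᵢ = wᵢ(ȳ))
-- holds of f(g), as g itself is a witness, hence it holds of g.  A witness
-- b for g satisfies the relators, so gᵢ ↦ bᵢ extends to an endomorphism β,
-- and β(f(gᵢ)) = wᵢ(b) = gᵢ makes β a left inverse of f.
module Submission where

open import Defs
open import Algebra.Bundles using (Group)
open import Algebra.Morphism.Construct.Composition using (isGroupHomomorphism)
open import Algebra.Morphism.Structures using (module GroupMorphisms)
open import Data.Fin.Base using (Fin)
open import Data.Fin.Patterns using (0F; 1F; 2F)
open import Data.List.Base using (List; []; _∷_; foldr; map; tabulate)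
open import Data.List.Membership.Propositional using (_∈_)
open import Data.List.Relation.Unary.All as All using (All; []; _∷_)
open import Data.List.Relation.Unary.All.Properties
  using (map⁺; map⁻; tabulate⁺; tabulate⁻)
open import Data.Nat.Base using (ℕ)
open import Data.Product.Base using (∃-syntax; _×_; _,_; proj₁; proj₂)
open import Data.Sum.Base using (inj₁; inj₂; [_,_])
import Data.Vec.Functional as Vector
open import Function.Base using (_∘_)
open import Function.Bundles using (Func; _⇔_; mk⇔; module Equivalence)
open import Level using (Level; 0ℓ; _⊔_)
import Relation.Binary.Reasoning.Setoid as ≈-Reasoning

private
  variable
    c ℓ c′ ℓ′ : Level
    n : ℕ
    X Y : Set

IsHomomorphism : (A : Group c ℓ) (B : Group c′ ℓ′) →
                 (Group.Carrier A → Group.Carrier B) → Set (c ⊔ ℓ ⊔ ℓ′)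
IsHomomorphism A B =
  GroupMorphisms.IsGroupHomomorphism (Group.rawGroup A) (Group.rawGroup B)

IsIsomorphism : (A : Group c ℓ) (B : Group c′ ℓ′) →
                (Group.Carrier A → Group.Carrier B) → Set (c ⊔ ℓ ⊔ c′ ⊔ ℓ′)
IsIsomorphism A B =
  GroupMorphisms.IsGroupIsomorphism (Group.rawGroup A) (Group.rawGroup B)

module _ (A : Group c ℓ) (B : Group c′ ℓ′) where
  private
    module A = Group A
    module B = Group B

  isHomomorphism : {f : A.Carrier → B.Carrier} →
    (∀ {x y} → x A.≈ y → f x B.≈ f y) →
    (∀ x y → f (x A.∙ y) B.≈ f x B.∙ f y) →
    f A.ε B.≈ B.ε →
    (∀ x → f (x A.⁻¹) B.≈ f x B.⁻¹) →
    IsHomomorphism A B f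
  isHomomorphism cong ∙-homo ε-homo ⁻¹-homo = record
    { isMonoidHomomorphism = record
      { isMagmaHomomorphism = record
        { isRelHomomorphism = record { cong = cong }
        ; homo              = ∙-homo
        }
      ; ε-homo = ε-homo
      }
    ; ⁻¹-homo = ⁻¹-homo
    }

module _ (A : Group c ℓ) (B : Group c′ ℓ′) {f : Group.Carrier A → Group.Carrier B}
         (f-iso : IsIsomorphism A B f) where
  private
    module A = Group A
    module B = Group B
  open GroupMorphisms.IsGroupIsomorphism f-iso
  open ≈-Reasoning B.setoid

  inverse : B.Carrier → A.Carrier
  inverse y = proj₁ (surjective y)

  f∘inverse : ∀ y → f (inverse y) B.≈ y
  -- `surjective` covers every argument equal to the chosen preimage; reflexivity picks out the
  -- preimage itself.
  f∘inverse y = proj₂ (surjective y) A.refl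

  -- Since `f` is injective, each law may be checked after applying `f`, where `f∘inverse` cancels
  -- and the law in `B` remains.
  inverse-isHomomorphism : IsHomomorphism B A inverse
  inverse-isHomomorphism = isHomomorphism B A
    (λ {x} {y} x≈y → injective (begin
      f (inverse x) ≈⟨ f∘inverse x ⟩
      x             ≈⟨ x≈y ⟩
      y             ≈⟨ f∘inverse y ⟨
      f (inverse y) ∎))
    (λ x y → injective (begin
      f (inverse (x B.∙ y))           ≈⟨ f∘inverse (x B.∙ y) ⟩
      x B.∙ y                         ≈⟨ B.∙-cong (f∘inverse x) (f∘inverse y) ⟨
      f (inverse x) B.∙ f (inverse y) ≈⟨ ∙-homo (inverse x) (inverse y) ⟨
      f (inverse x A.∙ inverse y)     ∎))
    (injective (B.trans (f∘inverse B.ε) (B.sym ε-homo)))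
    (λ x → injective (begin
      f (inverse (x B.⁻¹)) ≈⟨ f∘inverse (x B.⁻¹) ⟩
      x B.⁻¹               ≈⟨ B.⁻¹-cong (f∘inverse x) ⟨
      f (inverse x) B.⁻¹   ≈⟨ ⁻¹-homo (inverse x) ⟨
      f (inverse x A.⁻¹)   ∎))

rename : (X → Y) → Word X → Word Y
rename σ (var x) = var (σ x)
rename σ e       = e
rename σ (s · t) = rename σ s · rename σ t
rename σ (s ⁻)   = rename σ s ⁻

-- Positive formulas have no constant for truth; the trivial equation `e ≐ e` serves as the empty
-- conjunction.
⋀ : List (PositiveQF X) → PositiveQF X
⋀ = foldr _∧_ (e ≐ e)

module _ (A : Group c ℓ) where
  private module A = Group A

  eval-rename : (ρ : Y → A.Carrier) (σ : X → Y) (w : Word X) →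
                eval A ρ (rename σ w) A.≈ eval A (ρ ∘ σ) w
  eval-rename ρ σ (var x) = A.refl
  eval-rename ρ σ e       = A.refl
  eval-rename ρ σ (s · t) = A.∙-cong (eval-rename ρ σ s) (eval-rename ρ σ t)
  eval-rename ρ σ (s ⁻)   = A.⁻¹-cong (eval-rename ρ σ s)

  module _ {R : List (Word X)} {ρ : X → A.Carrier}
           (ρ-kills : ∀ {r} → r ∈ R → eval A ρ r A.≈ A.ε) where

    -- Von Dyck's theorem, by induction on derivations: `relator` is the hypothesis on `ρ`, and
    -- every other rule is a law valid in any group.
    eval-cong : ∀ {s t} → R ⊢ s ∼ t → eval A ρ s A.≈ eval A ρ t
    eval-cong (relator r∈R) = ρ-kills r∈R
    eval-cong refl          = A.refl
    eval-cong (sym p)       = A.sym (eval-cong p)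
    eval-cong (trans p q)   = A.trans (eval-cong p) (eval-cong q)
    eval-cong (·-cong p q)  = A.∙-cong (eval-cong p) (eval-cong q)
    eval-cong (⁻-cong p)    = A.⁻¹-cong (eval-cong p)
    eval-cong (assoc s t u) = A.assoc _ _ _
    eval-cong (identityˡ s) = A.identityˡ _
    eval-cong (identityʳ s) = A.identityʳ _
    eval-cong (inverseˡ s)  = A.inverseˡ _
    eval-cong (inverseʳ s)  = A.inverseʳ _

    eval-isHomomorphism : IsHomomorphism ⟨ X ∣ R ⟩ A (eval A ρ)
    eval-isHomomorphism = isHomomorphism ⟨ X ∣ R ⟩ A
      eval-cong (λ _ _ → A.refl) A.refl (λ _ → A.refl)

  -- The uniqueness half of the universal property of a presentation, by induction on words. It
  -- serves both to describe the given isomorphism and to compare two maps on generators.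
  eval-unique : {R : List (Word X)} {ρ : X → A.Carrier} {h : Word X → A.Carrier} →
    IsHomomorphism ⟨ X ∣ R ⟩ A h → (∀ x → h (var x) A.≈ ρ x) →
    ∀ w → h w A.≈ eval A ρ w
  eval-unique {ρ = ρ} {h} h-homo h-var = go
    where
    open GroupMorphisms.IsGroupHomomorphism h-homo
    go : ∀ w → h w A.≈ eval A ρ w
    go (var x) = h-var x
    go e       = ε-homo
    go (s · t) = A.trans (homo s t) (A.∙-cong (go s) (go t))
    go (s ⁻)   = A.trans (⁻¹-homo s) (A.⁻¹-cong (go s))

  ⋀⁺ : {ρ : X → A.Carrier} {θs : List (PositiveQF X)} →
       All (HoldsQF A ρ) θs → HoldsQF A ρ (⋀ θs)
  ⋀⁺ []       = A.refl
  ⋀⁺ (p ∷ ps) = p , ⋀⁺ ps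

  ⋀⁻ : {ρ : X → A.Carrier} (θs : List (PositiveQF X)) →
       HoldsQF A ρ (⋀ θs) → All (HoldsQF A ρ) θs
  ⋀⁻ []       _        = []
  ⋀⁻ (θ ∷ θs) (p , ps) = p ∷ ⋀⁻ θs ps

-- True of `a` exactly when some homomorphism from `⟨ Fin k ∣ R ⟩` sends each `w i` to `a i`.
-- Finiteness of the presentation makes this a single formula.
imageFormula : ∀ {k} → List (Word (Fin k)) → (Fin n → Word (Fin k)) → ∃⁺Formula n
imageFormula {k = k} R w = ∃⁺ k
  ( ⋀ (map (λ r → rename inj₂ r ≐ e) R)
  ∧ ⋀ (tabulate (λ i → var (inj₁ i) ≐ rename inj₂ (w i))))

module _ (A : Group c ℓ) {k : ℕ} (R : List (Word (Fin k)))
         (w : Fin n → Word (Fin k)) {a : Fin n → Group.Carrier A} where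
  open Group A using (_≈_; ε) renaming (sym to ≈-sym; trans to ≈-trans)

  -- Both directions only undo the encoding: a word renamed along `inj₂` has the same value at
  -- `[ a , b ]` as the original has at `b`.
  ⊨-imageFormula : (A ⊨ imageFormula R w [ a ]) ⇔
    (∃[ b ] (∀ {r} → r ∈ R → eval A b r ≈ ε) × (∀ i → a i ≈ eval A b (w i)))
  ⊨-imageFormula = mk⇔
    (λ (b , kills , images) → b
      , (λ {r} r∈R → ≈-trans (≈-sym (eval-rename A [ a , b ] inj₂ r))
                             (All.lookup (map⁻ (⋀⁻ A _ kills)) r∈R))
      , (λ i → ≈-trans (tabulate⁻ (⋀⁻ A _ images) i)
                       (eval-rename A [ a , b ] inj₂ (w i))))
    (λ (b , kills , images) → b
      , ⋀⁺ A (map⁺ (All.tabulate λ {r} r∈R →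
          ≈-trans (eval-rename A [ a , b ] inj₂ r) (kills r∈R)))
      , ⋀⁺ A (tabulate⁺ λ i →
          ≈-trans (images i) (≈-sym (eval-rename A [ a , b ] inj₂ (w i)))))

module _ (A : Group c ℓ) (B : Group c′ ℓ′)
         (f : Func (Group.setoid A) (Group.setoid B))
         (f-emb : Is∃⁺Embedding A B f) where
  private
    module A = Group A
    module B = Group B
  open Func f

  -- An equation is an ∃⁺-formula with an empty block of quantifiers, witnessed by the empty tuple.
  ∃⁺Embedding-preserves-≐ : (a : Fin n → A.Carrier) (s t : Word (Fin n)) →
    eval A a s A.≈ eval A a t → eval B (to ∘ a) s B.≈ eval B (to ∘ a) t
  ∃⁺Embedding-preserves-≐ {n} a s t s≈t =
    let b , p = Equivalence.to (f-emb n (∃⁺ 0 (rename inj₁ s ≐ rename inj₁ t)) a)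
                  ( (λ ())
                  , A.trans (eval-rename A _ inj₁ s)
                      (A.trans s≈t (A.sym (eval-rename A _ inj₁ t))))
    in B.trans (B.sym (eval-rename B [ to ∘ a , b ] inj₁ s))
         (B.trans p (eval-rename B [ to ∘ a , b ] inj₁ t))

  -- The graph of each group operation is defined by an equation. The result of the operation gets a
  -- variable of its own, so that `to` is applied to it as a whole.
  ∃⁺Embedding-isHomomorphism : IsHomomorphism A B to
  ∃⁺Embedding-isHomomorphism = isHomomorphism A B cong
    (λ x y → ∃⁺Embedding-preserves-≐ (x A.∙ y Vector.∷ x Vector.∷ y Vector.∷ Vector.[])
               (var 0F) (var 1F · var 2F) A.refl)
    (∃⁺Embedding-preserves-≐ (A.ε Vector.∷ Vector.[]) (var 0F) e A.refl)
    (λ x → ∃⁺Embedding-preserves-≐ (x A.⁻¹ Vector.∷ x Vector.∷ Vector.[])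
             (var 0F) (var 1F ⁻) A.refl)

module _ (A : Group c ℓ) {R : List (Word (Fin n))} {h : Word (Fin n) → Group.Carrier A}
         (h-iso : IsIsomorphism ⟨ Fin n ∣ R ⟩ A h) where
  private
    module A = Group A
    module h = GroupMorphisms.IsGroupIsomorphism h-iso

    F : Group 0ℓ 0ℓ
    F = ⟨ Fin n ∣ R ⟩

    g : Fin n → A.Carrier
    g = h ∘ var

    word : A.Carrier → Word (Fin n)
    word = inverse F A h-iso

  -- Turns the abstract isomorphism `h` into substitution of the generators `g` into words.
  h≈eval : ∀ w → h w A.≈ eval A g w
  h≈eval = eval-unique A h.isGroupHomomorphism (λ _ → A.refl)

  eval-word : ∀ x → eval A g (word x) A.≈ x
  eval-word x = A.trans (A.sym (h≈eval (word x))) (f∘inverse F A h-iso x)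

  presentation⇒finitelyGenerated : FinitelyGenerated A
  presentation⇒finitelyGenerated = n , g , λ x → word x , eval-word x

  generators-kill-relators : ∀ {r} → r ∈ R → eval A g r A.≈ A.ε
  generators-kill-relators {r} r∈R =
    A.trans (A.sym (h≈eval r)) (A.trans (h.⟦⟧-cong (relator r∈R)) h.ε-homo)

  ∃⁺Embedding-leftInverse : ∀ f → Is∃⁺Embedding A A f →
    ∃[ β ] IsEndomorphism A β × (∀ x → β (Func.to f x) A.≈ x)
  ∃⁺Embedding-leftInverse f f-emb = β , β-homo , β∘f≈id
    where
    open Func f
    open ≈-Reasoning A.setoid

    w : Fin n → Word (Fin n)
    w i = word (to (g i))

    witness : ∃[ b ] (∀ {r} → r ∈ R → eval A b r A.≈ A.ε) ×
                     (∀ i → g i A.≈ eval A b (w i))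
    -- From the inside out: `g` witnesses the formula at `to ∘ g`, the embedding reflects it to `g`,
    -- and the new witness is unpacked.
    witness = Equivalence.to (⊨-imageFormula A R w)
      (Equivalence.from (f-emb n (imageFormula R w) g)
        (Equivalence.from (⊨-imageFormula A R w)
          (g , generators-kill-relators , λ i → A.sym (eval-word (to (g i))))))

    b : Fin n → A.Carrier
    b = proj₁ witness

    b-kills-relators : ∀ {r} → r ∈ R → eval A b r A.≈ A.ε
    b-kills-relators = proj₁ (proj₂ witness)

    g≈w[b] : ∀ i → g i A.≈ eval A b (w i)
    g≈w[b] = proj₂ (proj₂ witness)

    β : A.Carrier → A.Carrier
    β = eval A b ∘ word

    β-homo : IsEndomorphism A β
    -- `β` factors through `F`: `word` respects equality up to derivability from `R`, and evaluation
    -- at `b` respects derivability because `b` kills the relators.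
    β-homo = isGroupHomomorphism A.trans (inverse-isHomomorphism F A h-iso)
               (eval-isHomomorphism A b-kills-relators)

    open GroupMorphisms.IsGroupHomomorphism β-homo using () renaming (⟦⟧-cong to β-cong)

    β∘f∘h-homo : IsHomomorphism F A (β ∘ to ∘ h)
    β∘f∘h-homo = isGroupHomomorphism A.trans h.isGroupHomomorphism
      (isGroupHomomorphism A.trans (∃⁺Embedding-isHomomorphism A A f f-emb) β-homo)

    β∘f≈id : ∀ x → β (to x) A.≈ x
    β∘f≈id x = begin
      β (to x)            ≈⟨ β-cong (cong (f∘inverse F A h-iso x)) ⟨
      -- On a generator, `β (to (g i))` unfolds to `eval A b (w i)`, which is `g i` by the choice of
      -- `b`; so `β ∘ to ∘ h` is evaluation at `g`.
      β (to (h (word x))) ≈⟨ eval-unique A β∘f∘h-homo (A.sym ∘ g≈w[b]) (word x) ⟩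
      eval A g (word x)   ≈⟨ eval-word x ⟩
      x                   ∎

theorem1p8 : ∀ {c ℓ} (A : Group c ℓ) →
    WeaklyHopfian A → FinitelyPresented A → StronglyDefinedBy∃⁺Types A
theorem1p8 A weaklyHopfian (n , R , h , h-iso) =
    presentation⇒finitelyGenerated A h-iso
  , λ f f-emb → weaklyHopfian (Func.to f)
      (∃⁺Embedding-isHomomorphism A A f f-emb)
      (∃⁺Embedding-leftInverse A h-iso f f-emb)
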